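{- Let $T$ be a (finite) tree and let $r \ge 1$ be an integer. Then the $r$-independence complex $\mathrm{Ind}_r(T)$ is vertex decomposable.
   Context: Graphs are finite and simple. For a graph $G$ and $A\subseteq V(G)$, $G[A]$ denotes the induced subgraph on $A$. A tree is a connected graph in which there is a unique path between every pair of distinct vertices. For an integer $r\ge 1$, a subset $A\subseteq V(G)$ is $r$-independent if every connected component of $G[A]$ has at most $r$ vertices. The $r$-independence complex $\mathrm{Ind}_r(G)$ is the simplicial complex whose faces are all $r$-independent subsets of $V(G)$. A simplicial complex $\Delta$ on a finite vertex set is a collection of subsets (faces) closed under taking subsets; facets are the inclusion-maximal faces. The empty complex $\{\emptyset\}$ has only the empty face, and the void complex $\emptyset$ has no faces. A simplex is a complex with exactly one facet (all subsets of a finite set). For a vertex $v$ of $\Delta$: $\mathrm{lk}_\Delta(v)=\{F\in\Delta : v\notin F,\ F\cup\{v\}\in\Delta\}$ and $\mathrm{del}_\Delta(v)=\{F\in\Delta : v\notin F\}$. $\Delta$ is vertex decomposable if either $\Delta$ is a simplex (including the cases $\emptyset$ and $\{\emptyset\}$), or there exists a vertex $v$ of $\Delta$ such that both $\mathrm{lk}_\Delta(v)$ and $\mathrm{del}_\Delta(v)$ are vertex decomposable and each facet of $\mathrm{del}_\Delta(v)$ is a facet of $\Delta$ (recursive definition; $\Delta$ is not required to be pure). -}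

module Defs where

open import Data.Empty using (⊥-elim)
open import Data.Fin.Base using (Fin; zero; suc)
open import Data.Fin.Subset using (Subset; inside; outside; _∈_; _∉_; _⊆_; _∪_; ⁅_⁆; ∣_∣)
open import Data.Fin.Subset.Properties using (p⊆q⇒∣p∣≤∣q∣; x∈p∪q⁻; x∈p∪q⁺)
open import Data.List.Base using (List; head; last)
open import Data.List.Relation.Unary.Linked using (Linked)
open import Data.List.Relation.Unary.Unique.Propositional using (Unique)
open import Data.Maybe.Base using (just)
open import Data.Nat.Base using (ℕ; zero; suc; _≤_)
open import Data.Nat.Properties using (_≤?_; ≤-trans)
open import Data.Product using (∃; ∃!; _×_; _,_; proj₁)
open import Data.Sum.Base using (_⊎_)
import Data.Sum.Base as Sum
open import Data.Vec.Base using ([]; _∷_; here; there)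
open import Function.Base using (_on_; _∘_; id)
open import Function.Bundles using (_⇔_; mk⇔; module Equivalence)
open import Relation.Binary.Construct.Closure.ReflexiveTransitive using (Star; gmap)
open import Relation.Binary.Definitions using (Decidable; Symmetric)
open import Relation.Binary.PropositionalEquality.Core using (_≡_; _≢_)
open import Relation.Nullary.Decidable.Core using (Dec; yes; no; decidable-stable)
open import Relation.Nullary.Negation.Core using (¬_)

------------------------------------------------------------------------
-- Graphs

-- Adjacency is decidable: classically this is no restriction.

record Graph (V : Set) : Set₁ where
  infix 4 _~_ _~?_
  field
    _~_    : V → V → Set
    _~?_   : Decidable _~_
    ~-sym  : Symmetric _~_
    ~-irr  : ∀ {v} → ¬ (v ~ v)

open Graph

module _ {V : Set} (G : Graph V) where

  Reachable : V → V → Set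
  Reachable = Star (_~_ G)

  Connected : Set
  Connected = ∀ u v → Reachable u v

  -- A path is given by its sequence of (pairwise distinct) vertices, so
  -- that uniqueness of paths does not depend on proofs of adjacency.

  IsPath : V → V → List V → Set
  IsPath u v xs =
    head xs ≡ just u × last xs ≡ just v × Linked (_~_ G) xs × Unique xs

  IsTree : Set
  IsTree = Connected × (∀ u v → u ≢ v → ∃! _≡_ (IsPath u v))

induced : ∀ {n} → Graph (Fin n) → (A : Subset n) → Graph (∃ λ v → v ∈ A)
induced G A = record
  { _~_   = _~_ G on proj₁
  ; _~?_  = λ u v → _~?_ G (proj₁ u) (proj₁ v)
  ; ~-sym = ~-sym G
  ; ~-irr = ~-irr G
  }

-- C is the vertex set of a connected component of G[A], i.e. the
-- reachability class in G[A] of some vertex u of G[A].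

IsComponent : ∀ {n} → Graph (Fin n) → Subset n → Subset n → Set
IsComponent G A C =
  ∃ λ u → ∀ w → w ∈ C ⇔ (∃ λ w∈A → Reachable (induced G A) u (w , w∈A))

Independent : ∀ {n} → ℕ → Graph (Fin n) → Subset n → Set
Independent r G A = ∀ C → IsComponent G A C → ∣ C ∣ ≤ r

------------------------------------------------------------------------
-- Simplicial complexes

-- Elements of the ground set Fin n need not be vertices of the complex,
-- and the void complex (no faces at all) is allowed.

record SimplicialComplex (n : ℕ) : Set₁ where
  field
    Face   : Subset n → Set
    closed : ∀ {F G} → F ⊆ G → Face G → Face F

open SimplicialComplex

module _ {n : ℕ} (Δ : SimplicialComplex n) where

  IsVertex : Fin n → Set
  IsVertex v = Face Δ ⁅ v ⁆

  IsFacet : Subset n → Set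
  IsFacet F = Face Δ F × (∀ G → Face Δ G → F ⊆ G → G ≡ F)

  IsVoid : Set
  IsVoid = ∀ F → ¬ Face Δ F

  IsSimplex : Set
  IsSimplex = IsVoid ⊎ ∃! _≡_ IsFacet

  lk : Fin n → SimplicialComplex n
  lk v = record
    { Face   = λ F → Face Δ F × v ∉ F × Face Δ (F ∪ ⁅ v ⁆)
    ; closed = λ {F} {G} F⊆G (ΔG , v∉G , ΔGv) →
        closed Δ F⊆G ΔG
        , v∉G ∘ F⊆G
        , closed Δ (x∈p∪q⁺ ∘ Sum.map F⊆G id ∘ x∈p∪q⁻ F ⁅ v ⁆) ΔGv
    }

  del : Fin n → SimplicialComplex n
  del v = record
    { Face   = λ F → Face Δ F × v ∉ F
    ; closed = λ F⊆G (ΔG , v∉G) → closed Δ F⊆G ΔG , v∉G ∘ F⊆G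
    }

data VertexDecomposable {n : ℕ} (Δ : SimplicialComplex n) : Set where
  simplex : IsSimplex Δ → VertexDecomposable Δ
  shed    : ∀ v → IsVertex Δ v →
            VertexDecomposable (lk Δ v) →
            VertexDecomposable (del Δ v) →
            (∀ F → IsFacet (del Δ v) F → IsFacet Δ F) →
            VertexDecomposable Δ

------------------------------------------------------------------------
-- The r-independence complex

¬¬-dec : ∀ {P : Set} → ¬ ¬ Dec P
¬¬-dec k = k (no (k ∘ yes))

-- Classically, every predicate on Fin n is given by a subset.

¬¬-comprehension : ∀ {n} (P : Fin n → Set) →
                   ¬ ¬ (∃ λ (D : Subset n) → ∀ x → x ∈ D ⇔ P x)
¬¬-comprehension {zero}  P k = k ([] , λ ())
¬¬-comprehension {suc n} P k =
  ¬¬-comprehension (P ∘ suc) λ (D , D⇔P) →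
  ¬¬-dec λ
    { (yes p) → k (inside ∷ D , λ
        { zero    → mk⇔ (λ _ → p) (λ _ → here)
        ; (suc x) → mk⇔ (λ { (there q) → Equivalence.to (D⇔P x) q })
                        (there ∘ Equivalence.from (D⇔P x)) })
    ; (no ¬p) → k (outside ∷ D , λ
        { zero    → mk⇔ (λ ()) (⊥-elim ∘ ¬p)
        ; (suc x) → mk⇔ (λ { (there q) → Equivalence.to (D⇔P x) q })
                        (there ∘ Equivalence.from (D⇔P x)) })
    }

independent-closed : ∀ {n} r (G : Graph (Fin n)) {A B : Subset n} →
                     A ⊆ B → Independent r G B → Independent r G A
independent-closed r G {A} {B} A⊆B indB C ((u , u∈A) , C⇔) =
  decidable-stable (∣ C ∣ ≤? r) λ C≰r →
  ¬¬-comprehension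
    (λ w → ∃ λ w∈B → Reachable (induced G B) (u , A⊆B u∈A) (w , w∈B))
    λ (D , D⇔) → C≰r (≤-trans
      (p⊆q⇒∣p∣≤∣q∣ λ {x} x∈C →
        let (x∈A , ux) = Equivalence.to (C⇔ x) x∈C in
        Equivalence.from (D⇔ x)
          (A⊆B x∈A , gmap (λ (y , y∈A) → y , A⊆B y∈A) id ux))
      (indB D ((u , A⊆B u∈A) , D⇔)))

Ind : ∀ {n} → ℕ → Graph (Fin n) → SimplicialComplex n
Ind r G = record
  { Face   = Independent r G
  ; closed = independent-closed r G
  }

{-# OPTIONS --safe #-}

-- Root the tree and let down S v be the set of descendants of v that reach v
-- inside S.  A connected component of S is down S t for its highest vertex t,
-- so S is r-independent iff every down S v has at most r elements.
--
-- Iterated links and deletions of Ind r T have the form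
-- {F ⊆ A : F ∪ B independent}.  Let U = A ∪ B.  If U is independent this is a
-- simplex; otherwise take v lowest with |down U v| > r, and c ∈ down U v ∖ B
-- with |down U c| maximal.  Then c is a shedding vertex: in an independent
-- S ∪ {c} with B ⊆ S ⊆ U, the vertex c can be traded for some w ∉ S ∪ {c}.
-- Either down U c ⊈ S ∪ {c}, and w is taken in down U c, where c ∉ S cuts it
-- off from v; or any w ∈ down U v ∖ (S ∪ {c}) works, because giving up c
-- frees all of down U c, which is at least as large as down U w.

module Submission where

open import Defs
open import Data.Nat.Base using (ℕ; _≤_)
open import Data.Fin.Base using (Fin)

open import Algebra.Bundles using (CommutativeMonoid)
import Algebra.Properties.CommutativeSemigroup as CommutativeSemigroupProperties
open import Data.Fin.Base using (zero)
open import Data.Fin.Properties using (_≟_; all?; any?; ¬∀⟶∃¬)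
open import Data.Fin.Subset
open import Data.Fin.Subset.Properties
open import Data.List.Base using (List; []; _∷_; [_]; last; filter; allFin)
import Data.List.Extrema
open import Data.List.Membership.DecPropositional using () renaming (_∈?_ to mem?)
import Data.List.Membership.Propositional as List
open import Data.List.Membership.Propositional.Properties using (∈-filter⁺; ∈-allFin)
open import Data.List.Relation.Unary.All as All using ([]; _∷_)
open import Data.List.Relation.Unary.All.Properties using (all-filter; ¬Any⇒All¬)
open import Data.List.Relation.Unary.AllPairs using ([]; _∷_)
open import Data.List.Relation.Unary.Any using (here; there)
open import Data.List.Relation.Unary.Linked using ([-]; _∷_)
open import Data.Maybe.Base using (just)
open import Data.Nat.Base using (zero; suc; _+_; _<_; z≤n; s≤s)
open import Data.Nat.Induction using (<-wellFounded)
import Data.Nat.Properties as ℕ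
open import Data.Product using (∃; ∃!; _×_; _,_; proj₁; proj₂; -,_)
open import Data.Sum.Base using (_⊎_; inj₁; inj₂; [_,_]′)
open import Data.Vec.Base using ([]; _∷_; here; there; tabulate)
open import Data.Vec.Properties using (lookup∘tabulate; []=⇒lookup; lookup⇒[]=)
open import Function.Base using (_∘_; id)
open import Function.Bundles using (_⇔_; mk⇔; module Equivalence)
open import Function.Construct.Symmetry using (⇔-sym)
open import Induction.WellFounded using (Acc; acc)
open import Level using (0ℓ)
open import Relation.Binary.Construct.Closure.ReflexiveTransitive using (ε; _◅_; _◅◅_)
open import Relation.Binary.Core using (Rel)
open import Relation.Binary.PropositionalEquality
  using (_≡_; _≢_; refl; sym; trans; cong; subst; isEquivalence)
open import Relation.Binary.Structures using (IsDecPartialOrder)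
open import Relation.Nullary using (¬_; Dec; yes; no; does; contradiction)
open import Relation.Nullary.Decidable using (_×-dec_; _→-dec_; ¬?; decidable-stable; dec-true)
open import Relation.Unary using (Decidable)

-- Subsets of `Fin n` and their cardinalities.

private variable
  n : ℕ

⟦_⟧ : {P : Fin n → Set} → Decidable P → Subset n
⟦ P? ⟧ = tabulate (does ∘ P?)

∈⟦⟧⁺ : {P : Fin n → Set} (P? : Decidable P) → ∀ {x} → P x → x ∈ ⟦ P? ⟧
∈⟦⟧⁺ P? {x} px =
  lookup⇒[]= x _ (trans (lookup∘tabulate (does ∘ P?) x) (dec-true (P? x) px))

∈⟦⟧⁻ : {P : Fin n → Set} (P? : Decidable P) → ∀ {x} → x ∈ ⟦ P? ⟧ → P x
∈⟦⟧⁻ P? {x} x∈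
  with P? x | trans (sym (lookup∘tabulate (does ∘ P?) x)) ([]=⇒lookup x∈)
... | yes px | _  = px
... | no  _  | ()

x∈p─q⇒x∉q : ∀ {x} (p q : Subset n) → x ∈ p ─ q → x ∉ q
x∈p─q⇒x∉q (_ ∷ p) (outside ∷ q) (there x∈) (there x∈q) = x∈p─q⇒x∉q p q x∈ x∈q
x∈p─q⇒x∉q (_ ∷ p) (inside  ∷ q) (there x∈) (there x∈q) = x∈p─q⇒x∉q p q x∈ x∈q

∣p∣≤∣p─q∣+∣q∣ : (p q : Subset n) → ∣ p ∣ ≤ ∣ p ─ q ∣ + ∣ q ∣
∣p∣≤∣p─q∣+∣q∣ []            []            = z≤n
∣p∣≤∣p─q∣+∣q∣ (inside  ∷ p) (inside  ∷ q) =
  ℕ.≤-trans (s≤s (∣p∣≤∣p─q∣+∣q∣ p q)) (ℕ.≤-reflexive (sym (ℕ.+-suc _ _)))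
∣p∣≤∣p─q∣+∣q∣ (inside  ∷ p) (outside ∷ q) = s≤s (∣p∣≤∣p─q∣+∣q∣ p q)
∣p∣≤∣p─q∣+∣q∣ (outside ∷ p) (inside  ∷ q) =
  ℕ.≤-trans (∣p∣≤∣p─q∣+∣q∣ p q) (ℕ.+-monoʳ-≤ _ (ℕ.n≤1+n _))
∣p∣≤∣p─q∣+∣q∣ (outside ∷ p) (outside ∷ q) = ∣p∣≤∣p─q∣+∣q∣ p q

q⊆p⇒∣p─q∣+∣q∣≤∣p∣ : (p q : Subset n) → q ⊆ p → ∣ p ─ q ∣ + ∣ q ∣ ≤ ∣ p ∣
q⊆p⇒∣p─q∣+∣q∣≤∣p∣ []            []            q⊆p = z≤n
q⊆p⇒∣p─q∣+∣q∣≤∣p∣ (inside  ∷ p) (inside  ∷ q) q⊆p =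
  ℕ.≤-trans (ℕ.≤-reflexive (ℕ.+-suc _ _)) (s≤s (q⊆p⇒∣p─q∣+∣q∣≤∣p∣ p q (drop-∷-⊆ q⊆p)))
q⊆p⇒∣p─q∣+∣q∣≤∣p∣ (inside  ∷ p) (outside ∷ q) q⊆p =
  s≤s (q⊆p⇒∣p─q∣+∣q∣≤∣p∣ p q (drop-∷-⊆ q⊆p))
q⊆p⇒∣p─q∣+∣q∣≤∣p∣ (outside ∷ p) (inside  ∷ q) q⊆p with () ← q⊆p here
q⊆p⇒∣p─q∣+∣q∣≤∣p∣ (outside ∷ p) (outside ∷ q) q⊆p =
  q⊆p⇒∣p─q∣+∣q∣≤∣p∣ p q (drop-∷-⊆ q⊆p)

-- Cuts `X` along `W` and `Y` along `C`; meant for a trade that turns `Y` into `X`, losing `C` and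
-- gaining at most `W`.
exchange-size : (X W Y C : Subset n) → X ─ W ⊆ Y ─ C → C ⊆ Y → ∣ W ∣ ≤ ∣ C ∣ → ∣ X ∣ ≤ ∣ Y ∣
exchange-size X W Y C X─W⊆Y─C C⊆Y W≤C = begin
  ∣ X ∣              ≤⟨ ∣p∣≤∣p─q∣+∣q∣ X W ⟩
  ∣ X ─ W ∣ + ∣ W ∣  ≤⟨ ℕ.+-mono-≤ (p⊆q⇒∣p∣≤∣q∣ X─W⊆Y─C) W≤C ⟩
  ∣ Y ─ C ∣ + ∣ C ∣  ≤⟨ q⊆p⇒∣p─q∣+∣q∣≤∣p∣ Y C C⊆Y ⟩
  ∣ Y ∣              ∎
  where open ℕ.≤-Reasoning

p⊈q⇒∃ : (p q : Subset n) → ¬ p ⊆ q → ∃ λ x → x ∈ p × x ∉ q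
p⊈q⇒∃ p q p⊈q with any? (λ x → (x ∈? p) ×-dec ¬? (x ∈? q))
... | yes found = found
... | no  ¬any  = contradiction
  (λ {x} x∈p → decidable-stable (x ∈? q) λ x∉q → ¬any (x , x∈p , x∉q)) p⊈q

x∈p⇒⁅x⁆⊆p : ∀ {x} {p : Subset n} → x ∈ p → ⁅ x ⁆ ⊆ p
x∈p⇒⁅x⁆⊆p {x = x} {p} x∈p y∈ = subst (_∈ p) (sym (x∈⁅y⁆⇒x≡y x y∈)) x∈p

p⊆r∧q⊆r⇒p∪q⊆r : {p q s : Subset n} → p ⊆ s → q ⊆ s → p ∪ q ⊆ s
p⊆r∧q⊆r⇒p∪q⊆r {p = p} {q} p⊆s q⊆s = [ p⊆s , q⊆s ]′ ∘ x∈p∪q⁻ p q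

maximiser : {P : Fin n → Set} → Decidable P → (f : Fin n → ℕ) → ∃ P →
            ∃ λ m → P m × (∀ x → P x → f x ≤ f m)
maximiser P? f (a , pa) =
  argmax f a xs
  , argmax-all f pa (all-filter P? (allFin _))
  , λ x px → All.lookup (f[xs]≤f[argmax] a xs) (∈-filter⁺ P? (∈-allFin x) px)
  where
  open Data.List.Extrema ℕ.≤-totalOrder
  xs = filter P? (allFin _)

-- Invariance of vertex decomposability.

open SimplicialComplex
open Equivalence

facet-resp : {Δ Γ : SimplicialComplex n} → (∀ F → Face Δ F ⇔ Face Γ F) →
             ∀ F → IsFacet Δ F → IsFacet Γ F
facet-resp Δ⇔Γ F (ΔF , max) =
  to (Δ⇔Γ F) ΔF , λ G ΓG → max G (from (Δ⇔Γ G) ΓG)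

-- Faces are predicates, so the links and deletions below are identified with other complexes only
-- up to logical equivalence.
vertexDecomposable-resp : {Δ Γ : SimplicialComplex n} →
                          (∀ F → Face Δ F ⇔ Face Γ F) →
                          VertexDecomposable Δ → VertexDecomposable Γ
vertexDecomposable-resp Δ⇔Γ (simplex (inj₁ void)) =
  simplex (inj₁ λ F → void F ∘ from (Δ⇔Γ F))
vertexDecomposable-resp {Δ = Δ} {Γ} Δ⇔Γ (simplex (inj₂ (F , facet , unique))) =
  simplex (inj₂ (F , facet-resp {Δ = Δ} {Γ} Δ⇔Γ F facet
                   , unique ∘ facet-resp {Δ = Γ} {Δ} (⇔-sym ∘ Δ⇔Γ) _))
vertexDecomposable-resp {Δ = Δ} {Γ} Δ⇔Γ (shed v vertex lkΔ delΔ shedding) =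
  shed v (to (Δ⇔Γ ⁅ v ⁆) vertex)
    (vertexDecomposable-resp lk⇔ lkΔ)
    (vertexDecomposable-resp del⇔ delΔ)
    (λ F → facet-resp {Δ = Δ} {Γ} Δ⇔Γ F ∘ shedding F
         ∘ facet-resp {Δ = del Γ v} {del Δ v} (⇔-sym ∘ del⇔) F)
  where
  lk⇔ : ∀ F → Face (lk Δ v) F ⇔ Face (lk Γ v) F
  lk⇔ F = mk⇔ (λ (a , b , c) → to (Δ⇔Γ _) a , b , to (Δ⇔Γ _) c)
              (λ (a , b , c) → from (Δ⇔Γ _) a , b , from (Δ⇔Γ _) c)
  del⇔ : ∀ F → Face (del Δ v) F ⇔ Face (del Γ v) F
  del⇔ F = mk⇔ (λ (a , b) → to (Δ⇔Γ _) a , b) (λ (a , b) → from (Δ⇔Γ _) a , b)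

-- Climbs and descendants in a rooted forest.

-- x ≼ v means that v is an ancestor of x; linear says that ancestors form a chain.
module Forest {n : ℕ} {_≼_ : Rel (Fin n) 0ℓ}
  (isDecPartialOrder : IsDecPartialOrder _≡_ _≼_)
  (linear : ∀ {x y z} → x ≼ y → x ≼ z → y ≼ z ⊎ z ≼ y)
  where

  open IsDecPartialOrder isDecPartialOrder using (antisym)
    renaming (refl to ≼-refl; trans to ≼-trans; _≤?_ to _≼?_)

  -- In a rooted tree the interval `[x , v]` is the path from `x` up to its ancestor `v`.
  Climb : Subset n → Fin n → Fin n → Set
  Climb S x v = x ≼ v × (∀ z → x ≼ z → z ≼ v → z ∈ S)

  climb? : ∀ S x v → Dec (Climb S x v)
  climb? S x v =
    (x ≼? v) ×-dec all? (λ z → (x ≼? z) →-dec ((z ≼? v) →-dec (z ∈? S)))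

  climb-refl : ∀ {S x} → x ∈ S → Climb S x x
  climb-refl {S} x∈S = ≼-refl , λ z x≼z z≼x → subst (_∈ S) (antisym x≼z z≼x) x∈S

  climb-trans : ∀ {S x y v} → Climb S x y → Climb S y v → Climb S x v
  climb-trans (x≼y , xy) (y≼v , yv) =
    ≼-trans x≼y y≼v
    , λ z x≼z z≼v → [ xy z x≼z , (λ y≼z → yv z y≼z z≼v) ]′ (linear x≼z x≼y)

  climb-lower : ∀ {S x y v} → x ≼ y → y ≼ v → Climb S x v → Climb S x y
  climb-lower x≼y y≼v (_ , xv) = x≼y , λ z x≼z z≼y → xv z x≼z (≼-trans z≼y y≼v)

  climb-upper : ∀ {S x y v} → x ≼ y → y ≼ v → Climb S x v → Climb S y v
  climb-upper x≼y y≼v (_ , xv) = y≼v , λ z y≼z → xv z (≼-trans x≼y y≼z)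

  climb-mono : ∀ {S S′ x v} → S ⊆ S′ → Climb S x v → Climb S′ x v
  climb-mono S⊆S′ (x≼v , xv) = x≼v , λ z x≼z z≼v → S⊆S′ (xv z x≼z z≼v)

  climb⇒source∈ : ∀ {S x v} → Climb S x v → x ∈ S
  climb⇒source∈ (x≼v , xv) = xv _ ≼-refl x≼v

  climb⇒target∈ : ∀ {S x v} → Climb S x v → v ∈ S
  climb⇒target∈ (x≼v , xv) = xv _ x≼v ≼-refl

  down : Subset n → Fin n → Subset n
  down S v = ⟦ (λ x → climb? S x v) ⟧

  ∈down⁺ : ∀ {S x v} → Climb S x v → x ∈ down S v
  ∈down⁺ {S} {v = v} = ∈⟦⟧⁺ (λ x → climb? S x v)

  ∈down⁻ : ∀ {S x v} → x ∈ down S v → Climb S x v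
  ∈down⁻ {S} {v = v} = ∈⟦⟧⁻ (λ x → climb? S x v)

  down-mono : ∀ {S S′ v} → S ⊆ S′ → down S v ⊆ down S′ v
  down-mono S⊆S′ = ∈down⁺ ∘ climb-mono S⊆S′ ∘ ∈down⁻

  -- Whatever lies on a climb to `v` itself climbs to `v`, so `down S v` contains the whole climb of
  -- each of its members.
  down-within : ∀ {S S′ v} → down S v ⊆ S′ → down S v ⊆ down S′ v
  down-within D⊆S′ x∈ = let xv = ∈down⁻ x∈ in
    ∈down⁺ (proj₁ xv , λ z x≼z z≼v → D⊆S′ (∈down⁺ (climb-upper x≼z z≼v xv)))

  down-⊂ : ∀ {S y v} → Climb S y v → y ≢ v → down S y ⊂ down S v
  down-⊂ yv y≢v =
    (λ x∈ → ∈down⁺ (climb-trans (∈down⁻ x∈) yv))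
    , _ , ∈down⁺ (climb-refl (climb⇒target∈ yv))
    , λ v∈ → y≢v (antisym (proj₁ yv) (proj₁ (∈down⁻ v∈)))

  -- Going up strictly enlarges `down S t`, so a `t` maximising its size cannot be passed.
  top : ∀ {S x} → x ∈ S → ∃ λ t → Climb S x t × (∀ t′ → Climb S t t′ → t′ ≡ t)
  top {S} x∈S =
    let t , xt , max = maximiser (climb? S _) (∣_∣ ∘ down S) (-, climb-refl x∈S) in
    t , xt , λ t′ tt′ → decidable-stable (t′ ≟ t) λ t′≢t →
      ℕ.<⇒≱ (p⊂q⇒∣p∣<∣q∣ (down-⊂ tt′ (t′≢t ∘ sym))) (max t′ (climb-trans xt tt′))

  -- Smallness and the choice of the shedding vertex.

  module _ (r : ℕ) where

    Small : Subset n → Set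
    Small S = ∀ v → ∣ down S v ∣ ≤ r

    small? : Decidable Small
    small? S = all? (λ v → ∣ down S v ∣ ℕ.≤? r)

    small-⊆ : ∀ {S S′} → S ⊆ S′ → Small S′ → Small S
    small-⊆ S⊆S′ small v = ℕ.≤-trans (p⊆q⇒∣p∣≤∣q∣ (down-mono S⊆S′)) (small v)

    record Shedding (U B : Subset n) : Set where
      field
        v c   : Fin n
        large : r < ∣ down U v ∣
        least : ∀ y → Climb U y v → y ≢ v → ∣ down U y ∣ ≤ r
        cv    : Climb U c v
        c∉B   : c ∉ B
        most  : ∀ x → Climb U x v → x ∉ B → ∣ down U x ∣ ≤ ∣ down U c ∣

    shedding : ∀ U B → ¬ Small U → Small B → Shedding U B
    shedding U B ¬smallU smallB = record
      { v = v ; c = c ; cv = cv ; c∉B = c∉B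
      ; large = ℕ.≰⇒> large
      ; least = λ y yv y≢v → decidable-stable (_ ℕ.≤? _) λ y≰r →
          ℕ.<⇒≱ (p⊂q⇒∣p∣<∣q∣ (p⊂q⇒∁p⊃∁q (down-⊂ yv y≢v))) (least y y≰r)
      ; most = λ x xv x∉B → most x (xv , x∉B)
      }
      where
      Large? : Decidable (λ v → ¬ ∣ down U v ∣ ≤ r)
      Large? v = ¬? (∣ down U v ∣ ℕ.≤? r)

      -- A largest complement gives a smallest, hence lowest, down U v.
      minimal = maximiser Large? (∣_∣ ∘ ∁ ∘ down U) (¬∀⟶∃¬ n _ (λ v → _ ℕ.≤? r) ¬smallU)
      v     = proj₁ minimal
      large = proj₁ (proj₂ minimal)
      least = proj₂ (proj₂ minimal)

      -- If `down U v` lay in `B`, it would lie in `down B v`, which has at most `r` elements.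
      escape : ∃ λ x → x ∈ down U v × x ∉ B
      escape = p⊈q⇒∃ _ _ λ D⊆B → large
        (ℕ.≤-trans (p⊆q⇒∣p∣≤∣q∣ (down-within D⊆B)) (smallB v))

      maximal = maximiser (λ x → climb? U x v ×-dec ¬? (x ∈? B)) (∣_∣ ∘ down U)
                  (let x , x∈ , x∉B = escape in x , ∈down⁻ x∈ , x∉B)
      c    = proj₁ maximal
      cv   = proj₁ (proj₁ (proj₂ maximal))
      c∉B  = proj₂ (proj₁ (proj₂ maximal))
      most = proj₂ (proj₂ maximal)

    module _ {U B : Subset n} (s : Shedding U B) where
      open Shedding s

      -- An element of [c , v] other than c outside B would contradict the maximality of c.
      above-c : ∀ {z} → c ≼ z → z ≼ v → z ≡ c ⊎ z ∈ B
      above-c {z} c≼z z≼v with z ≟ c | z ∈? B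
      ... | yes z≡c | _       = inj₁ z≡c
      ... | no  _   | yes z∈B = inj₂ z∈B
      ... | no  z≢c | no  z∉B = contradiction
        (most z (climb-upper c≼z z≼v cv) z∉B)
        (ℕ.<⇒≱ (p⊂q⇒∣p∣<∣q∣ (down-⊂ (climb-lower c≼z z≼v cv) (z≢c ∘ sym))))

      -- Trading `c` for another vertex.

      module _ {S : Subset n} (S⊆U : S ⊆ U) (B⊆S : B ⊆ S) (c∉S : c ∉ S)
               (small : Small (S ∪ ⁅ c ⁆)) where

        private
          S∪c : Subset n
          S∪c = S ∪ ⁅ c ⁆

          ∉S∪c⇒∉S : ∀ {x} → x ∉ S∪c → x ∉ S
          ∉S∪c⇒∉S x∉ = x∉ ∘ p⊆p∪q _

          ∉S∪c⇒≢c : ∀ {x} → x ∉ S∪c → x ≢ c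
          ∉S∪c⇒≢c x∉ refl = x∉ (q⊆p∪q S _ (x∈⁅x⁆ c))

          ∈S∪⁻ : ∀ {w x} → x ∈ S ∪ ⁅ w ⁆ → x ≡ w ⊎ x ∈ S
          ∈S∪⁻ {w} = [ inj₂ , inj₁ ∘ x∈⁅y⁆⇒x≡y w ]′ ∘ x∈p∪q⁻ S _

          D⊈S∪c : ¬ down U v ⊆ S∪c
          D⊈S∪c D⊆S∪c = ℕ.<⇒≱ large
            (ℕ.≤-trans (p⊆q⇒∣p∣≤∣q∣ (down-within D⊆S∪c)) (small v))

        module _ {w : Fin n} (wv : Climb U w v) (w∉S∪c : w ∉ S∪c) where

          private
            w∉S = ∉S∪c⇒∉S w∉S∪c
            w≢c = ∉S∪c⇒≢c w∉S∪c

            S∪w : Subset n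
            S∪w = S ∪ ⁅ w ⁆

            S∪w⊆U : S∪w ⊆ U
            S∪w⊆U = p⊆r∧q⊆r⇒p∪q⊆r S⊆U (x∈p⇒⁅x⁆⊆p (climb⇒source∈ wv))

            c∉S∪w : c ∉ S∪w
            c∉S∪w = [ w≢c ∘ sym , c∉S ]′ ∘ ∈S∪⁻

          -- A climb to `y` through `w` would yield one starting at `w`, so every climb to `y` stays
          -- in `S`.
          small-off : ∀ {y} → ¬ Climb S∪w w y → ∣ down S∪w y ∣ ≤ r
          small-off {y} ¬wy = ℕ.≤-trans (p⊆q⇒∣p∣≤∣q∣ avoids) (small y)
            where
            avoids : down S∪w y ⊆ down S∪c y
            avoids x∈ = let xy = ∈down⁻ x∈ in
              ∈down⁺ (proj₁ xy , λ z x≼z z≼y →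
                [ (λ { refl → contradiction (climb-upper x≼z z≼y xy) ¬wy })
                , p⊆p∪q _ ]′ (∈S∪⁻ (proj₂ xy z x≼z z≼y)))

          small-below : ∀ {y} → Climb S∪w w y → y ≼ v → y ≢ v → ∣ down S∪w y ∣ ≤ r
          small-below wy y≼v y≢v = ℕ.≤-trans
            (p⊆q⇒∣p∣≤∣q∣ (down-mono S∪w⊆U))
            (least _ (climb-upper (proj₁ wy) y≼v wv) y≢v)

          -- The trade loses `down U c`: from there every climb to `y` must pass `c`, which is
          -- absent. It gains at most `down U w`, since climbs from elsewhere avoid `w` and survive
          -- in `S∪c`. By `most` the gain does not exceed the loss.
          small-above : w ∉ down U c → down U c ⊆ S∪c →
                        ∀ {y} → Climb S∪w w y → v ≼ y → ∣ down S∪w y ∣ ≤ r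
          small-above w∉C C⊆S∪c {y} wy v≼y = ℕ.≤-trans
            (exchange-size (down S∪w y) (down U w) (down S∪c y) (down U c)
              X─W⊆Y─C C⊆Y (most w wv (w∉S ∘ B⊆S)))
            (small y)
            where
            c≼v = proj₁ cv

            v≼⇒∈S∪w : ∀ {z} → v ≼ z → z ≼ y → z ∈ S∪w
            v≼⇒∈S∪w v≼z = proj₂ wy _ (≼-trans (proj₁ wv) v≼z)

            c≼z≼v⇒z∈S∪c : ∀ {z} → c ≼ z → z ≼ v → z ∈ S∪c
            c≼z≼v⇒z∈S∪c c≼z z≼v =
              [ (λ { refl → q⊆p∪q S _ (x∈⁅x⁆ c) }) , p⊆p∪q _ ∘ B⊆S ]′ (above-c c≼z z≼v)

            -- Up to `v` the interval consists of `c` and elements of `B`; beyond `v` it belongs to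
            -- the climb of `w` to `y`. If `z = w` there, then `w ≼ v` leads back to the first part.
            cy : Climb S∪c c y
            cy = ≼-trans c≼v v≼y , λ z c≼z z≼y →
              [ c≼z≼v⇒z∈S∪c c≼z
              , (λ v≼z → [ (λ { refl → c≼z≼v⇒z∈S∪c c≼z (proj₁ wv) }) , p⊆p∪q _ ]′
                           (∈S∪⁻ (v≼⇒∈S∪w v≼z z≼y))) ]′ (linear c≼z c≼v)

            C⊆Y : down U c ⊆ down S∪c y
            C⊆Y x∈ = ∈down⁺ (climb-trans (∈down⁻ (down-within C⊆S∪c x∈)) cy)

            X─W⊆Y─C : down S∪w y ─ down U w ⊆ down S∪c y ─ down U c
            X─W⊆Y─C {x} x∈ = x∈p∧x∉q⇒x∈p─q
              (∈down⁺ (proj₁ xy , λ z x≼z z≼y →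
                [ (λ { refl → contradiction
                       (∈down⁺ (climb-mono S∪w⊆U (climb-lower x≼z z≼y xy))) x∉W })
                , p⊆p∪q _ ]′ (∈S∪⁻ (proj₂ xy z x≼z z≼y))))
              (λ x∈C → c∉S∪w (proj₂ xy c (proj₁ (∈down⁻ x∈C)) (proj₁ cy)))
              where
              xy : Climb S∪w x y
              xy = ∈down⁻ (p─q⊆p _ _ x∈)
              x∉W : x ∉ down U w
              x∉W = x∈p─q⇒x∉q _ _ x∈

          -- If `w` lies in `down U c`, it cannot climb as far as `v` without meeting the absent
          -- `c`; otherwise the count in `small-above` applies.
          small-over : w ∈ down U c ⊎ down U c ⊆ S∪c →
                       ∀ {y} → Climb S∪w w y → v ≼ y → ∣ down S∪w y ∣ ≤ r
          small-over choice wy v≼y with w ∈? down U c | choice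
          ... | yes w∈C | _         = contradiction
            (proj₂ wy c (proj₁ (∈down⁻ w∈C)) (≼-trans (proj₁ cv) v≼y)) c∉S∪w
          ... | no w∉C  | inj₁ w∈C  = contradiction w∈C w∉C
          ... | no w∉C  | inj₂ C⊆S∪c = small-above w∉C C⊆S∪c wy v≼y

          -- When `w` climbs to `y`, both `y` and `v` are ancestors of `w`, hence comparable. The
          -- case `y = v` joins the upper one, because `least` says nothing about `v` itself.
          small-swap : w ∈ down U c ⊎ down U c ⊆ S∪c → Small S∪w
          small-swap choice y with climb? S∪w w y
          ... | no ¬wy = small-off ¬wy
          ... | yes wy with linear (proj₁ wy) (proj₁ wv) | y ≟ v
          ... | inj₁ y≼v | no y≢v   = small-below wy y≼v y≢v
          ... | inj₁ _   | yes refl = small-over choice wy ≼-refl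
          ... | inj₂ v≼y | _        = small-over choice wy v≼y

        exchange : ∃ λ w → w ∈ U × w ∉ S ∪ ⁅ c ⁆ × Small (S ∪ ⁅ w ⁆)
        exchange with down U c ⊆? S∪c
        ... | no C⊈S∪c with w , w∈C , w∉S∪c ← p⊈q⇒∃ _ _ C⊈S∪c =
          w , climb⇒source∈ (∈down⁻ w∈C) , w∉S∪c
          , small-swap (climb-trans (∈down⁻ w∈C) cv) w∉S∪c (inj₁ w∈C)
        ... | yes C⊆S∪c with w , w∈D , w∉S∪c ← p⊈q⇒∃ _ _ D⊈S∪c =
          w , climb⇒source∈ (∈down⁻ w∈D) , w∉S∪c
          , small-swap (∈down⁻ w∈D) w∉S∪c (inj₂ C⊆S∪c)

    -- Links, deletions and the induction.

    -- The vertices of B have been linked, those outside A ∪ B deleted.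
    extensions : Subset n → Subset n → SimplicialComplex n
    extensions A B = record
      { Face   = λ F → F ⊆ A × Small (F ∪ B)
      ; closed = λ F⊆G (G⊆A , small) →
          ⊆-trans F⊆G G⊆A , small-⊆ (∪-monoˡ F⊆G) small
      }
      where
      ∪-monoˡ : ∀ {F G} → F ⊆ G → F ∪ B ⊆ G ∪ B
      ∪-monoˡ {F} {G} F⊆G = p⊆r∧q⊆r⇒p∪q⊆r (⊆-trans F⊆G (p⊆p∪q B)) (q⊆p∪q G B)

    simplex-extensions : ∀ A B → Small (A ∪ B) → IsSimplex (extensions A B)
    simplex-extensions A B small =
      inj₂ (A , ((id , small) , λ G (G⊆A , _) A⊆G → ⊆-antisym G⊆A A⊆G)
              , λ ((F⊆A , _) , max) → max A (id , small) F⊆A)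

    void-extensions : ∀ A B → ¬ Small B → IsSimplex (extensions A B)
    void-extensions A B ¬small = inj₁ λ F (_ , small) → ¬small (small-⊆ (q⊆p∪q F B) small)

    module _ {A B : Subset n} (s : Shedding (A ∪ B) B) where
      open Shedding s

      c∈A : c ∈ A
      c∈A = [ id , (λ c∈B → contradiction c∈B c∉B) ]′
              (x∈p∪q⁻ A B (climb⇒source∈ cv))

      private
        Δ : SimplicialComplex n
        Δ = extensions A B

        ⊆A-c : ∀ {F} → F ⊆ A → c ∉ F → F ⊆ A - c
        ⊆A-c F⊆A c∉F x∈F = x∈p∧x≢y⇒x∈p-y (F⊆A x∈F) λ { refl → c∉F x∈F }

        ⊆A-c⁻ : ∀ {F} → F ⊆ A - c → F ⊆ A × c ∉ F
        ⊆A-c⁻ F⊆ = ⊆-trans F⊆ (p─q⊆p A _)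
                 , λ c∈F → x∈p─q⇒x∉q A _ (F⊆ c∈F) (x∈⁅x⁆ c)

      del-face : ∀ F → Face (extensions (A - c) B) F ⇔ Face (del Δ c) F
      del-face F = mk⇔
        (λ (F⊆ , small) → let F⊆A , c∉F = ⊆A-c⁻ F⊆ in (F⊆A , small) , c∉F)
        (λ ((F⊆A , small) , c∉F) → ⊆A-c F⊆A c∉F , small)

      lk-face : ∀ F → Face (extensions (A - c) (⁅ c ⁆ ∪ B)) F ⇔ Face (lk Δ c) F
      lk-face F = mk⇔
        (λ (F⊆ , small) → let F⊆A , c∉F = ⊆A-c⁻ F⊆ in
          (F⊆A , small-⊆ (∪-monoʳ F (q⊆p∪q ⁅ c ⁆ B)) small)
          , c∉F
          , p⊆r∧q⊆r⇒p∪q⊆r F⊆A (x∈p⇒⁅x⁆⊆p c∈A)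
          , subst Small (sym (∪-assoc F ⁅ c ⁆ B)) small)
        (λ ((F⊆A , _) , c∉F , _ , small) →
          ⊆A-c F⊆A c∉F , subst Small (∪-assoc F ⁅ c ⁆ B) small)
        where
        ∪-monoʳ : ∀ p {q q′} → q ⊆ q′ → p ∪ q ⊆ p ∪ q′
        ∪-monoʳ p {q} {q′} q⊆q′ = p⊆r∧q⊆r⇒p∪q⊆r (p⊆p∪q q′) (⊆-trans q⊆q′ (q⊆p∪q p q′))

      -- If ⁅ c ⁆ ∪ B is already too large, c is not a vertex and cannot be shed, but
      -- deleting it changes nothing.
      no-vertex-face : ¬ IsVertex Δ c → ∀ F → Face (del Δ c) F ⇔ Face Δ F
      no-vertex-face ¬vertex F = mk⇔ proj₁ λ ΔF →
        ΔF , λ c∈F → ¬vertex (closed Δ (x∈p⇒⁅x⁆⊆p c∈F) ΔF)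

      -- A larger face of `Δ` containing `c` would make `F ∪ ⁅ c ⁆` a face. Then `exchange` for
      -- `S = F ∪ B` provides a `w` with `F ∪ ⁅ w ⁆` a face of the deletion, against the maximality
      -- of `F` there.
      del-facet : ∀ F → IsFacet (del Δ c) F → IsFacet Δ F
      del-facet F (((F⊆A , smallF) , c∉F) , max) = (F⊆A , smallF) , λ G ΔG F⊆G →
        max G (ΔG , λ c∈G → no-cone (closed Δ (p⊆r∧q⊆r⇒p∪q⊆r F⊆G (x∈p⇒⁅x⁆⊆p c∈G)) ΔG)) F⊆G
        where
        open CommutativeSemigroupProperties
          (CommutativeMonoid.commutativeSemigroup (∪-commutativeMonoid n)) using (xy∙z≈xz∙y)

        no-cone : ¬ Face Δ (F ∪ ⁅ c ⁆)
        no-cone (_ , small)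
          with w , w∈U , w∉ , smallʷ ← exchange s
                 (p⊆r∧q⊆r⇒p∪q⊆r (⊆-trans F⊆A (p⊆p∪q B)) (q⊆p∪q A B))
                 (q⊆p∪q F B)
                 ([ c∉F , c∉B ]′ ∘ x∈p∪q⁻ F B)
                 (subst Small (xy∙z≈xz∙y F ⁅ c ⁆ B) small) =
          let w∉S = w∉ ∘ p⊆p∪q ⁅ c ⁆
              w≢c = λ { refl → w∉ (q⊆p∪q (F ∪ B) ⁅ c ⁆ (x∈⁅x⁆ c)) }
              w∈A = [ id , (λ w∈B → contradiction (q⊆p∪q F B w∈B) w∉S) ]′ (x∈p∪q⁻ A B w∈U)
          in contradiction
            (subst (w ∈_)
              (max (F ∪ ⁅ w ⁆)
                ((p⊆r∧q⊆r⇒p∪q⊆r F⊆A (x∈p⇒⁅x⁆⊆p w∈A)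
                 , subst Small (xy∙z≈xz∙y F B ⁅ w ⁆) smallʷ)
                , [ c∉F , w≢c ∘ sym ∘ x∈⁅y⁆⇒x≡y w ]′ ∘ x∈p∪q⁻ F ⁅ w ⁆)
                (p⊆p∪q ⁅ w ⁆))
              (q⊆p∪q F ⁅ w ⁆ (x∈⁅x⁆ w)))
            (w∉S ∘ p⊆p∪q B)

      vertexDecomposable-step : (∀ B′ → VertexDecomposable (extensions (A - c) B′)) →
                                VertexDecomposable Δ
      vertexDecomposable-step rec with small? (⁅ c ⁆ ∪ B)
      ... | yes smallᶜ = shed c (x∈p⇒⁅x⁆⊆p c∈A , smallᶜ)
        (vertexDecomposable-resp lk-face (rec (⁅ c ⁆ ∪ B)))
        (vertexDecomposable-resp del-face (rec B))
        del-facet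
      ... | no ¬smallᶜ =
        vertexDecomposable-resp {Δ = del Δ c} {Δ} (no-vertex-face (¬smallᶜ ∘ proj₂))
          (vertexDecomposable-resp del-face (rec B))

    -- Induction on `∣ A ∣` for all `B` at once: link and deletion at `c` both live over `A - c`.
    vertexDecomposable-extensions : ∀ A B → Acc _<_ ∣ A ∣ → VertexDecomposable (extensions A B)
    vertexDecomposable-extensions A B (acc rec) with small? B | small? (A ∪ B)
    ... | no ¬smallB | _          = simplex (void-extensions A B ¬smallB)
    ... | yes _      | yes smallU = simplex (simplex-extensions A B smallU)
    ... | yes smallB | no ¬smallU =
      let s = shedding (A ∪ B) B ¬smallU smallB in
      vertexDecomposable-step s λ B′ →
        vertexDecomposable-extensions _ B′ (rec (x∈p⇒∣p-x∣<∣p∣ (c∈A s)))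

-- Paths in graphs.

last∈ : ∀ {A : Set} (x : A) xs {y} → last (x ∷ xs) ≡ just y → y List.∈ (x ∷ xs)
last∈ x []        refl = here refl
last∈ x (x′ ∷ xs) eq   = there (last∈ x′ xs eq)

module _ {V : Set} (G : Graph V) where

  open Graph G

  trivial-path : ∀ u → IsPath G u u [ u ]
  trivial-path u = refl , refl , [-] , [] ∷ []

  trivial-path-unique : ∀ {u xs} → IsPath G u u xs → [ u ] ≡ xs
  trivial-path-unique {xs = _ ∷ []}     (refl , _) = refl
  trivial-path-unique {xs = _ ∷ x ∷ xs} (refl , eq , _ , u∉ ∷ _) =
    contradiction refl (All.lookup u∉ (last∈ x xs eq))

  path-tail : ∀ {u v x y xs} → IsPath G u v (x ∷ y ∷ xs) → IsPath G y v (y ∷ xs)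
  path-tail (_ , eq , _ ∷ linked , _ ∷ unique) = refl , eq , linked , unique

  path-extend : ∀ {w u v xs} → w ~ u → w List.∉ xs → IsPath G u v xs → IsPath G w v (w ∷ xs)
  path-extend {xs = _ ∷ _} w~u w∉ (refl , eq , linked , unique) =
    refl , eq , w~u ∷ linked , ¬Any⇒All¬ _ w∉ ∷ unique

-- The ancestor order of a rooted tree.

module Rooted {n : ℕ} (T : Graph (Fin n)) (ρ : Fin n)
  (pathToRoot : ∀ u → ∃! _≡_ (IsPath T u ρ)) where

  open Graph T

  P : Fin n → List (Fin n)
  P u = proj₁ (pathToRoot u)

  P-path : ∀ u → IsPath T u ρ (P u)
  P-path u = proj₁ (proj₂ (pathToRoot u))

  P-unique : ∀ {u xs} → IsPath T u ρ xs → P u ≡ xs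
  P-unique {u} = proj₂ (proj₂ (pathToRoot u))

  infix 4 _≼_
  _≼_ : Rel (Fin n) 0ℓ
  u ≼ v = v List.∈ P u

  source∈ : ∀ {u xs} → IsPath T u ρ xs → u List.∈ xs
  source∈ {xs = _ ∷ _} (refl , _) = here refl

  -- Stated for any path `xs` so that the recursion can pass to tails; the tail starting at `y` is
  -- `P y` by uniqueness.
  on-path-trans : ∀ {u y z xs} → IsPath T u ρ xs → y List.∈ xs → y ≼ z → z List.∈ xs
  on-path-trans {xs = _ ∷ _}     p@(refl , _) (here refl) y≼z = subst (_ List.∈_) (P-unique p) y≼z
  on-path-trans {xs = _ ∷ _ ∷ _} p            (there y∈)  y≼z =
    there (on-path-trans (path-tail T p) y∈ y≼z)

  on-path-linear : ∀ {u y z xs} → IsPath T u ρ xs → y List.∈ xs → z List.∈ xs → y ≼ z ⊎ z ≼ y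
  on-path-linear {xs = _ ∷ _} p@(refl , _) (here refl) z∈ =
    inj₁ (subst (_ List.∈_) (sym (P-unique p)) z∈)
  on-path-linear {xs = _ ∷ _} p@(refl , _) y∈ (here refl) =
    inj₂ (subst (_ List.∈_) (sym (P-unique p)) y∈)
  on-path-linear {xs = _ ∷ _ ∷ _} p (there y∈) (there z∈) = on-path-linear (path-tail T p) y∈ z∈

  on-path-antisym : ∀ {u v xs} → IsPath T u ρ xs → v List.∈ xs → v ≼ u → u ≡ v
  on-path-antisym {xs = _ ∷ _}     (refl , _) (here refl) _ = refl
  on-path-antisym {xs = _ ∷ _ ∷ _} p@(refl , _ , _ , u∉ ∷ _) (there v∈) v≼u =
    contradiction refl (All.lookup u∉ (on-path-trans (path-tail T p) v∈ v≼u))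

  ≼-isDecPartialOrder : IsDecPartialOrder _≡_ _≼_
  ≼-isDecPartialOrder = record
    { isPartialOrder = record
      { isPreorder = record
        { isEquivalence = isEquivalence
        ; reflexive     = λ { {x} refl → source∈ (P-path x) }
        ; trans         = λ {x} → on-path-trans (P-path x)
        }
      ; antisym = λ {x} → on-path-antisym (P-path x)
      }
    ; _≟_  = _≟_
    ; _≤?_ = λ u v → mem? _≟_ v (P u)
    }

  -- Edges, parents and components.

  open IsDecPartialOrder ≼-isDecPartialOrder using (antisym)
    renaming (refl to ≼-refl; _≤?_ to _≼?_)
  open Forest ≼-isDecPartialOrder (λ {x} → on-path-linear (P-path x))

  Parent : Fin n → Fin n → Set
  Parent u v = P u ≡ u ∷ P v

  -- If `u` is not on `P v`, prepending it yields a path to the root, which must be `P u`; likewise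
  -- with the roles exchanged. If each is on the path of the other, antisymmetry makes them equal,
  -- which no edge allows.
  edge⇒parent : ∀ {u v} → u ~ v → Parent u v ⊎ Parent v u
  edge⇒parent {u} {v} u~v with v ≼? u | u ≼? v
  ... | no u∉Pv | _       = inj₁ (P-unique (path-extend T u~v u∉Pv (P-path v)))
  ... | yes _   | no v∉Pu = inj₂ (P-unique (path-extend T (~-sym u~v) v∉Pu (P-path u)))
  ... | yes v≼u | yes u≼v with refl ← antisym u≼v v≼u = contradiction u~v ~-irr

  parent⁻ : ∀ {u v z} → Parent u v → u ≼ z → z ≡ u ⊎ v ≼ z
  parent⁻ u→v u≼z with subst (_ List.∈_) u→v u≼z
  ... | here z≡u  = inj₁ z≡u
  ... | there v≼z = inj₂ v≼z

  parent⇒≼ : ∀ {u v} → Parent u v → u ≼ v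
  parent⇒≼ u→v = subst (_ List.∈_) (sym u→v) (there ≼-refl)

  parent-climb : ∀ {A u v} → Parent u v → u ∈ A → v ∈ A → Climb A u v
  parent-climb {A} u→v u∈A v∈A = parent⇒≼ u→v , λ z u≼z z≼v →
    [ (λ { refl → u∈A })
    , (λ v≼z → subst (_∈ A) (antisym v≼z z≼v) v∈A) ]′ (parent⁻ u→v u≼z)

  climb⇒reachable : ∀ {A x v} (v∈A : v ∈ A) → Climb A x v →
                    ∃ λ x∈A → Reachable (induced T A) (v , v∈A) (x , x∈A)
  climb⇒reachable {A} {x} {v} v∈A xv = along (P-path x) (proj₁ xv) xv
    where
    along : ∀ {x xs} → IsPath T x ρ xs → v List.∈ xs → Climb A x v →
            ∃ λ x∈A → Reachable (induced T A) (v , v∈A) (x , x∈A)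
    along {xs = _ ∷ _}     (refl , _) (here refl) _ = v∈A , ε
    along {xs = _ ∷ _ ∷ _} p@(refl , _ , x~y ∷ _ , _) (there v∈) xv =
      let tail   = path-tail T p
          x→y    = trans (P-unique p) (cong (_ ∷_) (sym (P-unique tail)))
          y≼v    = subst (v List.∈_) (sym (P-unique tail)) v∈
          _ , vy = along tail v∈ (climb-upper (parent⇒≼ x→y) y≼v xv)
      in climb⇒source∈ xv , vy ◅◅ (~-sym x~y ◅ ε)

  module _ {A : Subset n} {t : Fin n} (highest : ∀ t′ → Climb A t t′ → t′ ≡ t) where

    -- A child of `x` climbs through `x`. The parent of `x` lies on the climb to `t`, unless `x` is
    -- `t`, where it would extend the climb beyond `t`.
    climb-edge : ∀ {x y} → y ∈ A → x ~ y → Climb A x t → Climb A y t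
    climb-edge y∈A x~y xt with edge⇒parent x~y
    ... | inj₂ y→x = climb-trans (parent-climb y→x y∈A (climb⇒source∈ xt)) xt
    ... | inj₁ x→y with parent⁻ x→y (proj₁ xt)
    ...   | inj₂ y≼t  = climb-upper (parent⇒≼ x→y) y≼t xt
    ...   | inj₁ refl with refl ← highest _ (parent-climb x→y (climb⇒source∈ xt) y∈A) =
      contradiction x~y ~-irr

    component-below : ∀ {x y} → Climb A (proj₁ x) t → Reachable (induced T A) x y →
                      Climb A (proj₁ y) t
    component-below xt ε           = xt
    component-below xt (_◅_ {j = _ , y∈A} x~y y⇝z) = component-below (climb-edge y∈A x~y xt) y⇝z

  -- Agreement of independence and smallness.

  module _ (r : ℕ) where

    independent⇒small : ∀ A → Independent r T A → Small r A
    independent⇒small A independent v with v ∈? A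
    ... | no v∉A = ℕ.≤-trans (p⊆q⇒∣p∣≤∣q∣ {q = ⊥}
      (λ x∈ → contradiction (climb⇒target∈ (∈down⁻ x∈)) v∉A))
      (subst (_≤ r) (sym (∣⊥∣≡0 n)) z≤n)
    -- The component of `v`, which contains `down A v`, is available as a subset only up to double
    -- negation; that suffices for a decidable inequality.
    ... | yes v∈A = decidable-stable (_ ℕ.≤? r) λ large →
      ¬¬-comprehension (λ w → ∃ λ w∈A → Reachable (induced T A) (v , v∈A) (w , w∈A))
      λ (C , C⇔) → large (ℕ.≤-trans
        (p⊆q⇒∣p∣≤∣q∣ λ x∈ → from (C⇔ _) (climb⇒reachable v∈A (∈down⁻ x∈)))
        (independent C ((v , v∈A) , C⇔)))

    -- For `t` topmost above `u`, no edge of the induced subgraph leaves `down A t`, so it contains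
    -- the component of `u`.
    small⇒independent : ∀ A → Small r A → Independent r T A
    small⇒independent A small C ((u , u∈A) , C⇔) =
      let t , ut , highest = top u∈A in
      ℕ.≤-trans
        (p⊆q⇒∣p∣≤∣q∣ λ x∈C → ∈down⁺ (component-below highest ut (proj₂ (to (C⇔ _) x∈C))))
        (small t)

    extensions-face : ∀ F → Face (extensions r ⊤ ⊥) F ⇔ Face (Ind r T) F
    extensions-face F = mk⇔
      (small⇒independent F ∘ subst (Small r) (∪-identityʳ F) ∘ proj₂)
      full
      where
      full : Face (Ind r T) F → Face (extensions r ⊤ ⊥) F
      full independent =
        ⊆⊤ , subst (Small r) (sym (∪-identityʳ F)) (independent⇒small F independent)

    vertexDecomposable-Ind : VertexDecomposable (Ind r T)
    vertexDecomposable-Ind = vertexDecomposable-resp extensions-face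
      (vertexDecomposable-extensions r ⊤ ⊥ (<-wellFounded _))

-- `IsTree` speaks of distinct endpoints; on the diagonal the one-vertex path is unique because a
-- longer one would repeat its end.
tree⇒paths-unique : {T : Graph (Fin n)} → IsTree T → ∀ u v → ∃! _≡_ (IsPath T u v)
tree⇒paths-unique {T = T} (_ , paths) u v with u ≟ v
... | yes refl = [ u ] , trivial-path T u , trivial-path-unique T
... | no  u≢v  = paths u v u≢v

theorem1p1 : (n : ℕ) (T : Graph (Fin n)) → IsTree T →
    (r : ℕ) → 1 ≤ r → VertexDecomposable (Ind r T)
-- Without vertices there is no root to choose; the empty set is the only face.
theorem1p1 zero    T tree r _ = simplex (inj₂
  ([] , ((λ { _ ((() , _) , _) }) , λ { [] _ _ → refl }) , λ { {[]} _ → refl }))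
theorem1p1 (suc n) T tree r _ =
  Rooted.vertexDecomposable-Ind T zero (λ u → tree⇒paths-unique {T = T} tree u zero) r
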